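{- For a nonnegative integer $n$ let $f(n)=\sum_{j=0}^{n}(-1)^{j}S(n,j)$, where $S(n,j)$ are the Stirling numbers of the second kind. If $n\not\equiv 2 \pmod{3145728}$ and $n\not\equiv 2944838 \pmod{3145728}$, then $f(n)\neq 0$.
   Context: $S(n,k)$ denotes the Stirling number of the second kind, i.e. the number of partitions of an $n$-element set into exactly $k$ nonempty blocks (with $S(0,0)=1$); equivalently $x^n=\sum_{k\ge 0}S(n,k)(x)_k$ with $(x)_k=x(x-1)\cdots(x-k+1)$, $(x)_0=1$. -}

module Defs where

open import Data.Nat using (ℕ; zero; suc; _+_; _*_)
open import Data.Integer using (ℤ; +_; -_)
import Data.Integer as ℤ

-- Stirling numbers of the second kind S(n,k): number of partitions of an
-- n-element set into exactly k nonempty blocks, via the standard recurrence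
-- S(0,0)=1, S(0,k+1)=0, S(n+1,0)=0, S(n+1,k+1)=(k+1)S(n,k+1)+S(n,k).
S : ℕ → ℕ → ℕ
S zero    zero    = 1
S zero    (suc k) = 0
S (suc n) zero    = 0
S (suc n) (suc k) = suc k * S n (suc k) + S n k

sign : ℕ → ℤ
sign zero    = + 1
sign (suc j) = - sign j

sumTo : ℕ → (ℕ → ℤ) → ℤ
sumTo zero    g = g 0
sumTo (suc m) g = sumTo m g ℤ.+ g (suc m)

f : ℕ → ℤ
f n = sumTo n (λ j → sign j ℤ.* (+ S n j))

{-# OPTIONS --safe #-}

-- Let C_k = Σ_j binom(k,j) (x)_j be the monic Charlier polynomials and ℓ the linear functional with
-- ℓ((x)_j) = (-1)^j, so that f(n) = ℓ(x^n). Each ℓ(x^n C_k) is divisible by k!, hence modulo 2^22 the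
-- functional ℓ kills all multiples of C_24, and powers of x can be computed modulo 2^22 as combinations
-- of C_0, ..., C_23. For j ≤ 22 the sequence f is periodic modulo 2^j with period 3·2^j; splitting residue
-- classes modulo 3·2^j repeatedly in two and discarding those on which f is nonzero modulo 2^j leaves
-- only the two exceptional classes modulo 3·2^20.

module Submission where

open import Defs
open import Data.Bool using (Bool; true; false; _∧_; _∨_; not; T)
open import Data.Bool.Properties using (T-∧; T-∨; T-≡)
open import Data.Empty using (⊥)
open import Data.Fin using (zero; suc)
open import Data.Integer using (ℤ; +_; -_; 0ℤ; 1ℤ; -1ℤ)
import Data.Integer as ℤ
import Data.Integer.Properties as ℤ
open import Data.Integer.Tactic.RingSolver using (solve-∀)
open import Data.List using (List; []; _∷_; map; take; length)
open import Data.Nat using (ℕ; zero; suc; pred; _+_; _*_; _^_; _<_; s≤s; _≡ᵇ_; NonZero; _!)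
open import Data.Nat.DivMod
  using (_%_; _/_; _divMod_; result; m≡m%n+[m/n]*n; [m+kn]%n≡m%n)
open import Data.Nat.Divisibility
  using (_∣_; divides; m%n≡0⇒n∣m; n∣m⇒m%n≡0; ∣-trans; ∣m∣n⇒∣m+n; *-monoʳ-∣; _∣0; ∣-refl; m≤n⇒m!∣n!)
import Data.Nat.Properties as ℕ
import Data.Nat.Tactic.RingSolver as ℕSolver
open import Data.Product using (_,_; _×_; ∃)
open import Data.Sum using ([_,_]′)
open import Function using (_∘_; Equivalence)
open import Relation.Binary.Bundles using (Setoid)
import Relation.Binary.Reasoning.Setoid as SetoidReasoning
open import Relation.Binary.PropositionalEquality
  using (_≡_; _≢_; refl; sym; trans; cong; cong₂; subst; subst₂; module ≡-Reasoning)
open import Relation.Nullary using (contradiction)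

-- Finite sums and Stirling numbers

sumTo-cong : ∀ n {g h} → (∀ m → g m ≡ h m) → sumTo n g ≡ sumTo n h
sumTo-cong zero    e = e 0
sumTo-cong (suc n) e = cong₂ ℤ._+_ (sumTo-cong n e) (e (suc n))

sumTo-+ : ∀ n g h → sumTo n (λ m → g m ℤ.+ h m) ≡ sumTo n g ℤ.+ sumTo n h
sumTo-+ zero    g h = refl
sumTo-+ (suc n) g h rewrite sumTo-+ n g h = interchange (sumTo n g) (sumTo n h) (g (suc n)) (h (suc n))
  where
  interchange : ∀ a b c d → (a ℤ.+ b) ℤ.+ (c ℤ.+ d) ≡ (a ℤ.+ c) ℤ.+ (b ℤ.+ d)
  interchange = solve-∀

sumTo-* : ∀ n c g → sumTo n (λ m → c ℤ.* g m) ≡ c ℤ.* sumTo n g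
sumTo-* zero    c g = refl
sumTo-* (suc n) c g rewrite sumTo-* n c g = sym (ℤ.*-distribˡ-+ c _ _)

sumTo-suc : ∀ n g → sumTo (suc n) g ≡ g 0 ℤ.+ sumTo n (g ∘ suc)
sumTo-suc zero    g = refl
sumTo-suc (suc n) g rewrite sumTo-suc n g = ℤ.+-assoc (g 0) _ _

S-vanishes : ∀ {n k} → n < k → S n k ≡ 0
S-vanishes {zero}  {suc k} _         = refl
S-vanishes {suc n} {suc k} (s≤s n<k)
  rewrite S-vanishes n<k | S-vanishes (ℕ.m<n⇒m<1+n n<k) | ℕ.*-zeroʳ k = refl

-- Value at x^n of the functional sending (x)_m to (-1)^m g(m). Constant g = 1 gives ℓ, and g(m) =
-- (m)_k gives h ↦ ℓ(h C_k), because ℓ((x)_m C_k) = (-1)^m (m)_k.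
L : ℕ → (ℕ → ℤ) → ℤ
L n g = sumTo n (λ m → (sign m ℤ.* + S n m) ℤ.* g m)

L-cong : ∀ n {g h} → (∀ m → g m ≡ h m) → L n g ≡ L n h
L-cong n e = sumTo-cong n (λ m → cong ((sign m ℤ.* + S n m) ℤ.*_) (e m))

L-+ : ∀ n g h → L n (λ m → g m ℤ.+ h m) ≡ L n g ℤ.+ L n h
L-+ n g h = trans (sumTo-cong n (λ m → ℤ.*-distribˡ-+ (sign m ℤ.* + S n m) (g m) (h m)))
                  (sumTo-+ n _ _)

L-* : ∀ n c g → L n (λ m → c ℤ.* g m) ≡ c ℤ.* L n g
L-* n c g = trans (sumTo-cong n (λ m → swap (sign m ℤ.* + S n m) c (g m))) (sumTo-* n c _)
  where
  swap : ∀ a b d → a ℤ.* (b ℤ.* d) ≡ b ℤ.* (a ℤ.* d)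
  swap = solve-∀

-- The Stirling recurrence in dual form: x (x)_m = (x)_(m+1) + m (x)_m, where raising m flips the
-- sign.
L-suc : ∀ n g → L (suc n) g ≡ L n (λ m → + m ℤ.* g m ℤ.+ - g (suc m))
L-suc n g = begin
  L (suc n) g
    ≡⟨ sumTo-suc n _ ⟩
  0ℤ ℤ.+ sumTo n (λ m → (sign (suc m) ℤ.* + S (suc n) (suc m)) ℤ.* g (suc m))
    ≡⟨ ℤ.+-identityˡ _ ⟩
  sumTo n (λ m → (sign (suc m) ℤ.* + S (suc n) (suc m)) ℤ.* g (suc m))
    ≡⟨ sumTo-cong n expand ⟩
  sumTo n (λ m → w (suc m) ℤ.+ v m)
    ≡⟨ sumTo-+ n _ _ ⟩
  sumTo n (w ∘ suc) ℤ.+ sumTo n v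
    ≡⟨ cong (ℤ._+ sumTo n v) unshift ⟩
  sumTo n w ℤ.+ sumTo n v
    ≡⟨ sumTo-+ n w v ⟨
  sumTo n (λ m → w m ℤ.+ v m)
    ≡⟨ sumTo-cong n (λ m → ℤ.*-distribˡ-+ (sign m ℤ.* + S n m) (+ m ℤ.* g m) (- g (suc m))) ⟨
  L n (λ m → + m ℤ.* g m ℤ.+ - g (suc m)) ∎
  where
  open ≡-Reasoning
  w v : ℕ → ℤ
  w m = (sign m ℤ.* + S n m) ℤ.* (+ m ℤ.* g m)
  v m = (sign m ℤ.* + S n m) ℤ.* - g (suc m)

  algebra : ∀ e k a b c → (- e ℤ.* (k ℤ.* a ℤ.+ b)) ℤ.* c
                        ≡ (- e ℤ.* a) ℤ.* (k ℤ.* c) ℤ.+ (e ℤ.* b) ℤ.* - c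
  algebra = solve-∀

  expand : ∀ m → (sign (suc m) ℤ.* + S (suc n) (suc m)) ℤ.* g (suc m) ≡ w (suc m) ℤ.+ v m
  expand m = trans
    (cong (λ t → (- sign m ℤ.* t) ℤ.* g (suc m))
       (trans (ℤ.pos-+ (suc m * S n (suc m)) (S n m))
              (cong (ℤ._+ + S n m) (ℤ.pos-* (suc m) (S n (suc m))))))
    (algebra (sign m) (+ suc m) (+ S n (suc m)) (+ S n m) (g (suc m)))

  w-zero : w 0 ≡ 0ℤ
  w-zero = ℤ.*-zeroʳ (sign 0 ℤ.* + S n 0)

  w-last : w (suc n) ≡ 0ℤ
  w-last rewrite S-vanishes (ℕ.n<1+n n) | ℤ.*-zeroʳ (sign (suc n)) = refl

  -- Both boundary terms vanish: `w 0` has the factor 0, and `w (suc n)` contains S(n,n+1) = 0.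
  unshift : sumTo n (w ∘ suc) ≡ sumTo n w
  unshift = begin
    sumTo n (w ∘ suc)          ≡⟨ ℤ.+-identityˡ _ ⟨
    0ℤ ℤ.+ sumTo n (w ∘ suc)   ≡⟨ cong (ℤ._+ sumTo n (w ∘ suc)) w-zero ⟨
    w 0 ℤ.+ sumTo n (w ∘ suc)  ≡⟨ sumTo-suc n w ⟨
    sumTo n w ℤ.+ w (suc n)    ≡⟨ cong (λ t → sumTo n w ℤ.+ t) w-last ⟩
    sumTo n w ℤ.+ 0ℤ           ≡⟨ ℤ.+-identityʳ _ ⟩
    sumTo n w                  ∎

-- Falling factorials and Charlier moments

falling : ℕ → ℕ → ℕ
falling m       zero    = 1
falling zero    (suc k) = 0
falling (suc m) (suc k) = falling m (suc k) + suc k * falling m k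

falling-suc : ∀ m k → falling (suc m) k ≡ falling m k + k * falling m (pred k)
falling-suc m zero    = refl
falling-suc m (suc k) = refl

-- This is (m)_(k+1) = (m - k) (m)_k without subtraction. As `falling` is not defined as a product,
-- it takes an induction on m that uses the hypothesis at both k+1 and k.
*-falling : ∀ m k → m * falling m k ≡ falling m (suc k) + k * falling m k
*-falling zero    zero    = refl
*-falling zero    (suc k) = sym (ℕ.*-zeroʳ k)
*-falling (suc m) zero    = begin
  suc m * 1                          ≡⟨⟩
  suc (m * 1)                        ≡⟨ cong suc (*-falling m 0) ⟩
  suc (falling m 1 + 0)              ≡⟨ arith (falling m 1) ⟩
  falling m 1 + 1 + 0                ∎
  where
  open ≡-Reasoning
  arith : ∀ a → suc (a + 0) ≡ a + 1 + 0
  arith = ℕSolver.solve-∀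
*-falling (suc m) (suc k) = begin
  suc m * (a + suc k * b)            ≡⟨ split m (suc k) a b ⟩
  (a + suc k * b) + (m * a + suc k * (m * b))
    ≡⟨ cong₂ (λ s t → (a + suc k * b) + (s + suc k * t)) (*-falling m (suc k)) (*-falling m k) ⟩
  (a + suc k * b) + ((c + suc k * a) + suc k * (a + k * b))
    ≡⟨ join k a b c ⟩
  (c + suc (suc k) * a) + suc k * (a + suc k * b) ∎
  where
  open ≡-Reasoning
  a b c : ℕ
  a = falling m (suc k)
  b = falling m k
  c = falling m (suc (suc k))
  split : ∀ m l a b → suc m * (a + l * b) ≡ (a + l * b) + (m * a + l * (m * b))
  split = ℕSolver.solve-∀
  join : ∀ k a b c → (a + suc k * b) + ((c + suc k * a) + suc k * (a + k * b))
                   ≡ (c + suc (suc k) * a) + suc k * (a + suc k * b)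
  join = ℕSolver.solve-∀

-- The Pascal-style recursion of `falling` makes this immediate: (m)_k is k! times a binomial
-- coefficient, and each summand of the recursion carries the factor.
k!∣falling : ∀ m k → k ! ∣ falling m k
k!∣falling m       zero    = ∣-refl
k!∣falling zero    (suc k) = (suc k !) ∣0
k!∣falling (suc m) (suc k) = ∣m∣n⇒∣m+n (k!∣falling m (suc k)) (*-monoʳ-∣ (suc k) (k!∣falling m k))

-- A n k = ℓ(x^n C_k).
A : ℕ → ℕ → ℤ
A n k = L n (λ m → + falling m k)

A-zero : ∀ n → A n 0 ≡ f n
A-zero n = sumTo-cong n (λ m → ℤ.*-identityʳ _)

-- The three-term recurrence x C_k = C_(k+1) + (k-1) C_k - k C_(k-1) under ℓ(x^n ·). At k = 0 the
-- factor k removes the meaningless last term.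
A-suc : ∀ n k → A (suc n) k ≡ A n (suc k) ℤ.+ ((+ k ℤ.+ -1ℤ) ℤ.* A n k ℤ.+ - (+ k) ℤ.* A n (pred k))
A-suc n k = begin
  A (suc n) k
    ≡⟨ L-suc n _ ⟩
  L n (λ m → + m ℤ.* + falling m k ℤ.+ - (+ falling (suc m) k))
    ≡⟨ L-cong n pointwise ⟩
  L n (λ m → + falling m (suc k) ℤ.+ ((+ k ℤ.+ -1ℤ) ℤ.* + falling m k ℤ.+ - (+ k) ℤ.* + falling m (pred k)))
    ≡⟨ L-+ n _ _ ⟩
  A n (suc k) ℤ.+ L n (λ m → (+ k ℤ.+ -1ℤ) ℤ.* + falling m k ℤ.+ - (+ k) ℤ.* + falling m (pred k))
    ≡⟨ cong (λ t → A n (suc k) ℤ.+ t) 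
         (trans (L-+ n (λ m → (+ k ℤ.+ -1ℤ) ℤ.* + falling m k) (λ m → - (+ k) ℤ.* + falling m (pred k)))
            (cong₂ ℤ._+_ (L-* n (+ k ℤ.+ -1ℤ) (λ m → + falling m k))
                         (L-* n (- (+ k)) (λ m → + falling m (pred k))))) ⟩
  A n (suc k) ℤ.+ ((+ k ℤ.+ -1ℤ) ℤ.* A n k ℤ.+ - (+ k) ℤ.* A n (pred k)) ∎
  where
  open ≡-Reasoning
  pos-+* : ∀ a b c → + (a + b * c) ≡ + a ℤ.+ + b ℤ.* + c
  pos-+* a b c = trans (ℤ.pos-+ a (b * c)) (cong (λ t → + a ℤ.+ t) (ℤ.pos-* b c))

  algebra : ∀ k a b c → (a ℤ.+ k ℤ.* b) ℤ.+ - (b ℤ.+ k ℤ.* c)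
                      ≡ a ℤ.+ ((k ℤ.+ -1ℤ) ℤ.* b ℤ.+ - k ℤ.* c)
  algebra = solve-∀

  pointwise : ∀ m → + m ℤ.* + falling m k ℤ.+ - (+ falling (suc m) k)
    ≡ + falling m (suc k) ℤ.+ ((+ k ℤ.+ -1ℤ) ℤ.* + falling m k ℤ.+ - (+ k) ℤ.* + falling m (pred k))
  pointwise m = trans
    (cong₂ (λ s t → s ℤ.+ - t)
       (trans (sym (ℤ.pos-* m (falling m k))) (trans (cong +_ (*-falling m k)) (pos-+* _ k _)))
       (trans (cong +_ (falling-suc m k)) (pos-+* _ k _)))
    (algebra (+ k) (+ falling m (suc k)) (+ falling m k) (+ falling m (pred k)))

k!-divides-A : ∀ n k → ∃ λ b → A n k ≡ + (k !) ℤ.* b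
k!-divides-A n k = L n (λ m → + _∣_.quotient (k!∣falling m k)) , trans (L-cong n pointwise)
     (L-* n (+ (k !)) (λ m → + _∣_.quotient (k!∣falling m k)))
  where
  pointwise : ∀ m → + falling m k ≡ + (k !) ℤ.* + _∣_.quotient (k!∣falling m k)
  pointwise m = trans (cong +_ (trans (_∣_.equality (k!∣falling m k)) (ℕ.*-comm _ (k !))))
                      (ℤ.pos-* (k !) _)

-- Coefficient lists

infixl 6 _⊕_
_⊕_ : List ℕ → List ℕ → List ℕ
[]          ⊕ q       = q
p@(_ ∷ _)   ⊕ []      = p
(a ∷ p)     ⊕ (b ∷ q) = a + b ∷ p ⊕ q

infixr 7 _·_
_·_ : ℕ → List ℕ → List ℕ
c · p = map (c *_) p

weight : ℕ → List ℕ → List ℕ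
weight l []      = []
weight l (a ∷ p) = l * a ∷ weight (suc l) p

-- The forward difference in the Charlier basis, since C_k(x+1) - C_k(x) = k C_(k-1)(x).
lower : List ℕ → List ℕ
lower []      = []
lower (_ ∷ p) = weight 1 p

constant : List ℕ → ℕ
constant []      = 0
constant (a ∷ _) = a

-- With s = `A n` this is ℓ(x^n Σ_k p_k C_k).
eval : List ℕ → (ℕ → ℤ) → ℤ
eval []      s = 0ℤ
eval (a ∷ p) s = + a ℤ.* s 0 ℤ.+ eval p (s ∘ suc)

eval-cong : ∀ p {s t} → (∀ k → s k ≡ t k) → eval p s ≡ eval p t
eval-cong []      e = refl
eval-cong (a ∷ p) e = cong₂ ℤ._+_ (cong (+ a ℤ.*_) (e 0)) (eval-cong p (e ∘ suc))

eval-+ : ∀ p s t → eval p (λ k → s k ℤ.+ t k) ≡ eval p s ℤ.+ eval p t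
eval-+ []      s t = refl
eval-+ (a ∷ p) s t = trans
  (cong (λ z → + a ℤ.* (s 0 ℤ.+ t 0) ℤ.+ z) (eval-+ p (s ∘ suc) (t ∘ suc)))
  (algebra (+ a) (s 0) (t 0) (eval p (s ∘ suc)) (eval p (t ∘ suc)))
  where
  algebra : ∀ a b c d e → a ℤ.* (b ℤ.+ c) ℤ.+ (d ℤ.+ e) ≡ (a ℤ.* b ℤ.+ d) ℤ.+ (a ℤ.* c ℤ.+ e)
  algebra = solve-∀

eval-* : ∀ p c s → eval p (λ k → c ℤ.* s k) ≡ c ℤ.* eval p s
eval-* []      c s = sym (ℤ.*-zeroʳ c)
eval-* (a ∷ p) c s = trans
  (cong (λ z → + a ℤ.* (c ℤ.* s 0) ℤ.+ z) (eval-* p c (s ∘ suc)))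
  (algebra (+ a) c (s 0) (eval p (s ∘ suc)))
  where
  algebra : ∀ a c b d → a ℤ.* (c ℤ.* b) ℤ.+ c ℤ.* d ≡ c ℤ.* (a ℤ.* b ℤ.+ d)
  algebra = solve-∀

eval-⊕ : ∀ p q s → eval (p ⊕ q) s ≡ eval p s ℤ.+ eval q s
eval-⊕ []      q       s = sym (ℤ.+-identityˡ _)
eval-⊕ (a ∷ p) []      s = sym (ℤ.+-identityʳ _)
eval-⊕ (a ∷ p) (b ∷ q) s = trans
  (cong₂ ℤ._+_ (cong (ℤ._* s 0) (ℤ.pos-+ a b)) (eval-⊕ p q (s ∘ suc)))
  (algebra (+ a) (+ b) (s 0) (eval p (s ∘ suc)) (eval q (s ∘ suc)))
  where
  algebra : ∀ a b c d e → (a ℤ.+ b) ℤ.* c ℤ.+ (d ℤ.+ e) ≡ (a ℤ.* c ℤ.+ d) ℤ.+ (b ℤ.* c ℤ.+ e)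
  algebra = solve-∀

eval-· : ∀ c p s → eval (c · p) s ≡ + c ℤ.* eval p s
eval-· c []      s = sym (ℤ.*-zeroʳ (+ c))
eval-· c (a ∷ p) s = trans
  (cong₂ ℤ._+_ (cong (ℤ._* s 0) (ℤ.pos-* c a)) (eval-· c p (s ∘ suc)))
  (algebra (+ c) (+ a) (s 0) (eval p (s ∘ suc)))
  where
  algebra : ∀ c a b d → (c ℤ.* a) ℤ.* b ℤ.+ c ℤ.* d ≡ c ℤ.* (a ℤ.* b ℤ.+ d)
  algebra = solve-∀

eval-weight : ∀ l p s → eval (weight l p) s ≡ eval p (λ k → + (l + k) ℤ.* s k)
eval-weight l []      s = refl
eval-weight l (a ∷ p) s = cong₂ ℤ._+_
  (trans (cong (ℤ._* s 0) (ℤ.pos-* l a))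
     (trans (swap (+ l) (+ a) (s 0)) (cong (λ t → + a ℤ.* (+ t ℤ.* s 0)) (sym (ℕ.+-identityʳ l)))))
  (trans (eval-weight (suc l) p (s ∘ suc))
     (eval-cong p (λ k → cong (λ t → + t ℤ.* s (suc k)) (sym (ℕ.+-suc l k)))))
  where
  swap : ∀ l a b → (l ℤ.* a) ℤ.* b ≡ a ℤ.* (l ℤ.* b)
  swap = solve-∀

eval-lower : ∀ p s → eval (lower p) s ≡ eval p (λ k → + k ℤ.* s (pred k))
eval-lower []      s = refl
eval-lower (a ∷ p) s = trans (eval-weight 1 p s)
  (sym (trans (cong (ℤ._+ _) (ℤ.*-zeroʳ (+ a))) (ℤ.+-identityˡ _)))

-- The recurrence moved onto coefficients: multiplication by x acts on a list as shift plus
-- `weight 0` minus identity minus `lower`.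
eval-A-suc : ∀ p n → eval p (A (suc n))
  ≡ eval p (A n ∘ suc) ℤ.+ ((eval (weight 0 p) (A n) ℤ.+ -1ℤ ℤ.* eval p (A n)) ℤ.+ -1ℤ ℤ.* eval (lower p) (A n))
eval-A-suc p n = begin
  eval p (A (suc n))
    ≡⟨ eval-cong p (λ k → trans (A-suc n k) (algebra (+ k) (A n (suc k)) (A n k) (A n (pred k)))) ⟩
  eval p (λ k → A n (suc k) ℤ.+ ((+ k ℤ.* A n k ℤ.+ -1ℤ ℤ.* A n k) ℤ.+ -1ℤ ℤ.* (+ k ℤ.* A n (pred k))))
    ≡⟨ trans (eval-+ p _ _) (cong (λ t → eval p (A n ∘ suc) ℤ.+ t)
         (trans (eval-+ p _ _) (cong₂ ℤ._+_
           (trans (eval-+ p _ _) (cong₂ ℤ._+_ (sym (eval-weight 0 p (A n))) (eval-* p -1ℤ _)))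
           (trans (eval-* p -1ℤ _) (cong (-1ℤ ℤ.*_) (sym (eval-lower p (A n)))))))) ⟩
  eval p (A n ∘ suc) ℤ.+ ((eval (weight 0 p) (A n) ℤ.+ -1ℤ ℤ.* eval p (A n)) ℤ.+ -1ℤ ℤ.* eval (lower p) (A n)) ∎
  where
  open ≡-Reasoning
  algebra : ∀ k a b c → a ℤ.+ ((k ℤ.+ -1ℤ) ℤ.* b ℤ.+ - k ℤ.* c)
                      ≡ a ℤ.+ ((k ℤ.* b ℤ.+ -1ℤ ℤ.* b) ℤ.+ -1ℤ ℤ.* (k ℤ.* c))
  algebra = solve-∀

-- Orthogonality to constants: ℓ(C_0) = 1 and ℓ(C_k) = 0 for k > 0, so ℓ reads off the first
-- coefficient.
eval-A₀ : ∀ p → eval p (A 0) ≡ + constant p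
eval-A₀ []      = refl
eval-A₀ (a ∷ p) = trans (cong₂ ℤ._+_ (ℤ.*-identityʳ (+ a)) (vanishing p)) (ℤ.+-identityʳ _)
  where
  vanishing : ∀ q → eval q (λ _ → 0ℤ) ≡ 0ℤ
  vanishing q = eval-* q 0ℤ (λ _ → 0ℤ)

-- Residues of x ^ a

-- A coefficient list p stands for Σ_k p_k C_k; modulo M = suc m only the terms with k < N matter.
module Modular (m N : ℕ) (M∣N! : suc m ∣ N !) where

  M : ℕ
  M = suc m

  infix 4 _≈_
  -- Congruence modulo M with an explicit quotient, which turns the closure properties below into
  -- ring identities.
  record _≈_ (x y : ℤ) : Set where
    constructor mod
    field
      quotient : ℤ
      equality : x ≡ y ℤ.+ quotient ℤ.* + M

  ≡⇒≈ : ∀ {x y} → x ≡ y → x ≈ y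
  ≡⇒≈ {y = y} e = mod 0ℤ (trans e (sym (ℤ.+-identityʳ y)))

  ≈-refl : ∀ {x} → x ≈ x
  ≈-refl = ≡⇒≈ refl

  ≈-sym : ∀ {x y} → x ≈ y → y ≈ x
  ≈-sym {y = y} (mod q refl) = mod (- q) (algebra y q (+ M))
    where
    algebra : ∀ y q M → y ≡ (y ℤ.+ q ℤ.* M) ℤ.+ - q ℤ.* M
    algebra = solve-∀

  ≈-trans : ∀ {x y z} → x ≈ y → y ≈ z → x ≈ z
  ≈-trans {z = z} (mod q refl) (mod r refl) = mod (r ℤ.+ q) (algebra z r q (+ M))
    where
    algebra : ∀ z r q M → (z ℤ.+ r ℤ.* M) ℤ.+ q ℤ.* M ≡ z ℤ.+ (r ℤ.+ q) ℤ.* M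
    algebra = solve-∀

  ≈-setoid : Setoid _ _
  ≈-setoid = record
    { _≈_ = _≈_ ; isEquivalence = record { refl = ≈-refl ; sym = ≈-sym ; trans = ≈-trans } }

  module ≈-Reasoning = SetoidReasoning ≈-setoid

  +-cong : ∀ {x y z w} → x ≈ y → z ≈ w → x ℤ.+ z ≈ y ℤ.+ w
  +-cong {y = y} {w = w} (mod q refl) (mod r refl) = mod (q ℤ.+ r) (algebra y w q r (+ M))
    where
    algebra : ∀ y w q r M → (y ℤ.+ q ℤ.* M) ℤ.+ (w ℤ.+ r ℤ.* M) ≡ (y ℤ.+ w) ℤ.+ (q ℤ.+ r) ℤ.* M
    algebra = solve-∀

  *-congˡ : ∀ c {x y} → x ≈ y → c ℤ.* x ≈ c ℤ.* y
  *-congˡ c {y = y} (mod q refl) = mod (c ℤ.* q) (algebra c y q (+ M))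
    where
    algebra : ∀ c y q M → c ℤ.* (y ℤ.+ q ℤ.* M) ≡ c ℤ.* y ℤ.+ (c ℤ.* q) ℤ.* M
    algebra = solve-∀

  *-congʳ : ∀ {x y} c → x ≈ y → x ℤ.* c ≈ y ℤ.* c
  *-congʳ {x} {y} c x≈y = subst₂ _≈_ (ℤ.*-comm c x) (ℤ.*-comm c y) (*-congˡ c x≈y)

  %≡0⇒≈0 : ∀ x → x % M ≡ 0 → + x ≈ 0ℤ
  %≡0⇒≈0 x e with m%n≡0⇒n∣m x M e
  ... | divides q refl = mod (+ q) (trans (ℤ.pos-* q M) (sym (ℤ.+-identityˡ _)))

  ≈0⇒%≡0 : ∀ x → + x ≈ 0ℤ → x % M ≡ 0
  ≈0⇒%≡0 x (mod q e) = n∣m⇒m%n≡0 x M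
    (divides ℤ.∣ q ∣ (trans (cong ℤ.∣_∣ (trans e (ℤ.+-identityˡ (q ℤ.* + M)))) (ℤ.abs-* q (+ M))))

  %-≈ : ∀ x → + (x % M) ≈ + x
  %-≈ x = ≈-sym (mod (+ (x / M)) (trans (cong +_ (m≡m%n+[m/n]*n x M))
    (trans (ℤ.pos-+ (x % M) (x / M * M)) (cong (λ t → + (x % M) ℤ.+ t) (ℤ.pos-* (x / M) M)))))

  m≈-1 : + m ≈ -1ℤ
  m≈-1 = mod 1ℤ (sym (cong (λ t → -1ℤ ℤ.+ t) (ℤ.*-identityˡ (+ M))))

  k!≈0 : ∀ k → + ((N + k) !) ≈ 0ℤ
  k!≈0 k = %≡0⇒≈0 _ (n∣m⇒m%n≡0 _ M (∣-trans M∣N! (m≤n⇒m!∣n! (ℕ.m≤m+n N k))))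

  A≈0 : ∀ n k → A n (N + k) ≈ 0ℤ
  A≈0 n k with k!-divides-A n (N + k)
  ... | b , e = ≈-trans (≡⇒≈ e) (*-congʳ b (k!≈0 k))

  -- Leaves all values ℓ(x^n ·) unchanged modulo M, because M divides k! for k ≥ N. It bounds length
  -- and entries, so powers with large exponents stay computable.
  reduce : List ℕ → List ℕ
  reduce p = map (_% M) (take N p)

  eval-map-% : ∀ p s → eval (map (_% M) p) s ≈ eval p s
  eval-map-% []      s = ≈-refl
  eval-map-% (a ∷ p) s = +-cong (*-congʳ (s 0) (%-≈ a)) (eval-map-% p (s ∘ suc))

  eval-≈0 : ∀ p {s} → (∀ k → s k ≈ 0ℤ) → eval p s ≈ 0ℤ
  eval-≈0 []      e = ≈-refl
  eval-≈0 (a ∷ p) e = +-cong (≈-trans (*-congˡ (+ a) (e 0)) (≡⇒≈ (ℤ.*-zeroʳ (+ a)))) (eval-≈0 p (e ∘ suc))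

  eval-take : ∀ n p {s} → (∀ k → s (n + k) ≈ 0ℤ) → eval (take n p) s ≈ eval p s
  eval-take zero    p       e = ≈-sym (eval-≈0 p e)
  eval-take (suc n) []      e = ≈-refl
  eval-take (suc n) (a ∷ p) {s} e = +-cong (≈-refl {+ a ℤ.* s 0}) (eval-take n p {s ∘ suc} e)

  eval-reduce : ∀ p n → eval (reduce p) (A n) ≈ eval p (A n)
  eval-reduce p n = ≈-trans (eval-map-% (take N p) (A n)) (eval-take N p (A≈0 n))

  -- C_(k+1) = (x - (k - 1)) C_k + k C_(k-1), with m in place of -1 modulo M.
  next : ℕ → List ℕ → List ℕ → List ℕ
  next k u u′ = reduce ((0 ∷ u) ⊕ weight 0 u ⊕ m · (lower u ⊕ k · u) ⊕ k · u′)

  -- Here `u` stands for x^a C_k and `u′` for x^a C_(k-1). The factor k in the second hypothesis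
  -- makes it vacuous at k = 0, where `u′` is arbitrary.
  module _ (a k : ℕ) (u u′ : List ℕ)
           (hu  : ∀ n → eval u (A n) ≈ A (a + n) k)
           (hu′ : ∀ n → + k ℤ.* eval u′ (A n) ≈ + k ℤ.* A (a + n) (pred k)) where

    eval-next : ∀ n → eval (next k u u′) (A n) ≈ A (a + n) (suc k)
    eval-next n = begin
      eval (next k u u′) (A n)
        ≈⟨ eval-reduce ((0 ∷ u) ⊕ weight 0 u ⊕ m · (lower u ⊕ k · u) ⊕ k · u′) n ⟩
      eval ((0 ∷ u) ⊕ weight 0 u ⊕ m · (lower u ⊕ k · u) ⊕ k · u′) (A n)
        ≡⟨ expand ⟩
      ((s ℤ.+ w) ℤ.+ + m ℤ.* (l ℤ.+ + k ℤ.* e)) ℤ.+ + k ℤ.* e′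
        ≈⟨ +-cong (+-cong (≈-refl {s ℤ.+ w}) (*-congʳ (l ℤ.+ + k ℤ.* e) m≈-1)) ≈-refl ⟩
      ((s ℤ.+ w) ℤ.+ -1ℤ ℤ.* (l ℤ.+ + k ℤ.* e)) ℤ.+ + k ℤ.* e′
        ≡⟨ regroup s w l (+ k) e e′ ⟩
      ((s ℤ.+ ((w ℤ.+ -1ℤ ℤ.* e) ℤ.+ -1ℤ ℤ.* l)) ℤ.+ (1ℤ ℤ.+ - (+ k)) ℤ.* e) ℤ.+ + k ℤ.* e′
        ≡⟨ cong (λ t → (t ℤ.+ (1ℤ ℤ.+ - (+ k)) ℤ.* e) ℤ.+ + k ℤ.* e′) (eval-A-suc u n) ⟨
      (eval u (A (suc n)) ℤ.+ (1ℤ ℤ.+ - (+ k)) ℤ.* e) ℤ.+ + k ℤ.* e′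
        ≈⟨ +-cong (+-cong (hu (suc n)) (*-congˡ (1ℤ ℤ.+ - (+ k)) (hu n))) (hu′ n) ⟩
      (A (a + suc n) k ℤ.+ (1ℤ ℤ.+ - (+ k)) ℤ.* A (a + n) k) ℤ.+ + k ℤ.* A (a + n) (pred k)
        ≡⟨ cong (λ t → (t ℤ.+ (1ℤ ℤ.+ - (+ k)) ℤ.* A (a + n) k) ℤ.+ + k ℤ.* A (a + n) (pred k))
             (trans (cong (λ t → A t k) (ℕ.+-suc a n)) (A-suc (a + n) k)) ⟩
      ((A (a + n) (suc k) ℤ.+ ((+ k ℤ.+ -1ℤ) ℤ.* A (a + n) k ℤ.+ - (+ k) ℤ.* A (a + n) (pred k)))
        ℤ.+ (1ℤ ℤ.+ - (+ k)) ℤ.* A (a + n) k) ℤ.+ + k ℤ.* A (a + n) (pred k)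
        ≡⟨ cancel (+ k) (A (a + n) (suc k)) (A (a + n) k) (A (a + n) (pred k)) ⟩
      A (a + n) (suc k) ∎
      where
      open ≈-Reasoning
      s w l e e′ : ℤ
      s  = eval u (A n ∘ suc)
      w  = eval (weight 0 u) (A n)
      l  = eval (lower u) (A n)
      e  = eval u (A n)
      e′ = eval u′ (A n)

      expand : eval ((0 ∷ u) ⊕ weight 0 u ⊕ m · (lower u ⊕ k · u) ⊕ k · u′) (A n)
             ≡ ((s ℤ.+ w) ℤ.+ + m ℤ.* (l ℤ.+ + k ℤ.* e)) ℤ.+ + k ℤ.* e′
      expand =
        trans (eval-⊕ ((0 ∷ u) ⊕ weight 0 u ⊕ m · (lower u ⊕ k · u)) (k · u′) (A n)) (cong₂ ℤ._+_
          (trans (eval-⊕ ((0 ∷ u) ⊕ weight 0 u) (m · (lower u ⊕ k · u)) (A n)) (cong₂ ℤ._+_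
            (trans (eval-⊕ (0 ∷ u) (weight 0 u) (A n)) (cong (ℤ._+ w) (ℤ.+-identityˡ s)))
            (trans (eval-· m (lower u ⊕ k · u) (A n)) (cong (+ m ℤ.*_)
              (trans (eval-⊕ (lower u) (k · u) (A n)) (cong (λ t → l ℤ.+ t) (eval-· k u (A n))))))))
          (eval-· k u′ (A n)))

      regroup : ∀ s w l k e e′ → ((s ℤ.+ w) ℤ.+ -1ℤ ℤ.* (l ℤ.+ k ℤ.* e)) ℤ.+ k ℤ.* e′
        ≡ ((s ℤ.+ ((w ℤ.+ -1ℤ ℤ.* e) ℤ.+ -1ℤ ℤ.* l)) ℤ.+ (1ℤ ℤ.+ - k) ℤ.* e) ℤ.+ k ℤ.* e′
      regroup = solve-∀

      cancel : ∀ k a b c → ((a ℤ.+ ((k ℤ.+ -1ℤ) ℤ.* b ℤ.+ - k ℤ.* c)) ℤ.+ (1ℤ ℤ.+ - k) ℤ.* b) ℤ.+ k ℤ.* c ≡ a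
      cancel = solve-∀

  -- Represents x^a Σ_l p_l C_(k+l), with the products x^a C_(k+l) generated on the way by the
  -- three-term recurrence.
  mulFrom : ℕ → List ℕ → List ℕ → List ℕ → List ℕ
  mulFrom k []      u u′ = []
  mulFrom k (c ∷ p) u u′ = reduce (c · u ⊕ mulFrom (suc k) p (next k u u′) u)

  eval-mulFrom : ∀ {a} k p {u u′} →
    (∀ n → eval u (A n) ≈ A (a + n) k) →
    (∀ n → + k ℤ.* eval u′ (A n) ≈ + k ℤ.* A (a + n) (pred k)) →
    ∀ n → eval (mulFrom k p u u′) (A n) ≈ eval p (λ l → A (a + n) (k + l))
  eval-mulFrom k []      hu hu′ n = ≈-refl
  eval-mulFrom {a} k (c ∷ p) {u} {u′} hu hu′ n = begin
    eval (reduce (c · u ⊕ rest)) (A n)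
      ≈⟨ eval-reduce (c · u ⊕ rest) n ⟩
    eval (c · u ⊕ rest) (A n)
      ≡⟨ trans (eval-⊕ (c · u) rest (A n)) (cong (ℤ._+ eval rest (A n)) (eval-· c u (A n))) ⟩
    + c ℤ.* eval u (A n) ℤ.+ eval rest (A n)
      ≈⟨ +-cong (*-congˡ (+ c) (hu n))
           -- The old `u` becomes the new `u′`, as `pred (suc k)` is k.
           (eval-mulFrom {a} (suc k) p (eval-next a k u u′ hu hu′) (λ n → *-congˡ (+ suc k) (hu n)) n) ⟩
    + c ℤ.* A (a + n) k ℤ.+ eval p (λ l → A (a + n) (suc k + l))
      ≡⟨ cong₂ ℤ._+_ (cong (λ t → + c ℤ.* A (a + n) t) (sym (ℕ.+-identityʳ k)))
                     (eval-cong p (λ l → cong (A (a + n)) (sym (ℕ.+-suc k l)))) ⟩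
    + c ℤ.* A (a + n) (k + 0) ℤ.+ eval p (λ l → A (a + n) (k + suc l)) ∎
    where
    open ≈-Reasoning
    rest : List ℕ
    rest = mulFrom (suc k) p (next k u u′) u

  mul : List ℕ → List ℕ → List ℕ
  mul p q = mulFrom 0 p q []

  -- The list represents x^a as far as ℓ can see modulo M. Testing against every x^n is what lets
  -- representations be multiplied.
  record Power (p : List ℕ) (a : ℕ) : Set where
    field
      shift : ∀ n → eval p (A n) ≈ A (a + n) 0
  open Power

  mul-power : ∀ {p q a b} → Power p a → Power q b → Power (mul p q) (a + b)
  mul-power {p} {a = a} {b} hp hq .shift n = ≈-trans
    (eval-mulFrom {b} 0 p (hq .shift) (λ _ → ≈-refl) n)
    (≈-trans (hp .shift (b + n)) (≡⇒≈ (cong (λ t → A t 0) (sym (ℕ.+-assoc a b n)))))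

  one-power : Power (1 ∷ []) 0
  one-power .shift n = ≡⇒≈ (trans (ℤ.+-identityʳ _) (ℤ.*-identityˡ (A n 0)))

  -- From C_1 = 1 + x: x = C_1 - C_0, with `m` for -1.
  x : List ℕ
  x = m ∷ 1 ∷ []

  x-power : Power x 1
  x-power .shift n = ≈-trans
    (+-cong (*-congʳ (A n 0) m≈-1) ≈-refl)
    (≡⇒≈ (trans (algebra (A n 0) (A n 1)) (sym (A-suc n 0))))
    where
    algebra : ∀ a b → -1ℤ ℤ.* a ℤ.+ (1ℤ ℤ.* b ℤ.+ 0ℤ) ≡ b ℤ.+ (-1ℤ ℤ.* a ℤ.+ 0ℤ)
    algebra = solve-∀

  x² x³ : List ℕ
  x² = mul x x
  x³ = mul x x²

  x²-power : Power x² 2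
  x²-power = mul-power x-power x-power

  x³-power : Power x³ 3
  x³-power = mul-power x-power x²-power

  constant-≈ : ∀ {p a} → Power p a → + constant p ≈ f a
  constant-≈ {p} {a} h = ≈-trans (≡⇒≈ (sym (eval-A₀ p)))
    (≈-trans (h .shift 0) (≡⇒≈ (trans (cong (λ t → A t 0) (ℕ.+-identityʳ a)) (A-zero a))))

  -- Verified periods

  isZero : ℕ → Bool
  isZero x = x % M ≡ᵇ 0

  isZero⇒≈0 : ∀ x → T (isZero x) → + x ≈ 0ℤ
  isZero⇒≈0 x t = %≡0⇒≈0 x (ℕ.≡ᵇ⇒≡ (x % M) 0 t)

  ≈0⇒isZero : ∀ x → + x ≈ 0ℤ → T (isZero x)
  ≈0⇒isZero x e = ℕ.≡⇒≡ᵇ (x % M) 0 (≈0⇒%≡0 x e)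

  -- Since k ! divides A n k, it is enough that d * p_k * k ! vanishes modulo M for all k.
  annihilates : ℕ → ℕ → List ℕ → Bool
  annihilates d k []      = true
  annihilates d k (a ∷ p) = isZero (d * (a * k !)) ∧ annihilates d (suc k) p

  annihilates-sound : ∀ d k p → T (annihilates d k p) → ∀ n → + d ℤ.* eval p (λ l → A n (k + l)) ≈ 0ℤ
  annihilates-sound d k []      t n = ≡⇒≈ (ℤ.*-zeroʳ (+ d))
  annihilates-sound d k (a ∷ p) t n with Equivalence.to T-∧ t | k!-divides-A n k
  ... | t₁ , t₂ | b , e = begin
    + d ℤ.* (+ a ℤ.* A n (k + 0) ℤ.+ eval p (λ l → A n (k + suc l)))
      ≡⟨ cong₂ (λ x y → + d ℤ.* (+ a ℤ.* x ℤ.+ y)) (trans (cong (A n) (ℕ.+-identityʳ k)) e)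
                                    (eval-cong p (λ l → cong (A n) (ℕ.+-suc k l))) ⟩
    + d ℤ.* (+ a ℤ.* (+ (k !) ℤ.* b) ℤ.+ eval p (λ l → A n (suc k + l)))
      ≡⟨ algebra (+ d) (+ a) (+ (k !)) b (eval p (λ l → A n (suc k + l))) ⟩
    (+ d ℤ.* (+ a ℤ.* + (k !))) ℤ.* b ℤ.+ + d ℤ.* eval p (λ l → A n (suc k + l))
      ≡⟨ cong (λ t → t ℤ.* b ℤ.+ + d ℤ.* eval p (λ l → A n (suc k + l)))
           (trans (cong (+ d ℤ.*_) (sym (ℤ.pos-* a (k !)))) (sym (ℤ.pos-* d (a * k !)))) ⟩
    + (d * (a * k !)) ℤ.* b ℤ.+ + d ℤ.* eval p (λ l → A n (suc k + l))
      ≈⟨ +-cong (*-congʳ b (isZero⇒≈0 (d * (a * k !)) t₁)) (annihilates-sound d (suc k) p t₂ n) ⟩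
    0ℤ ℤ.* b ℤ.+ 0ℤ
      ≡⟨⟩
    0ℤ ∎
    where
    open ≈-Reasoning
    algebra : ∀ d a k b e → d ℤ.* (a ℤ.* (k ℤ.* b) ℤ.+ e) ≡ (d ℤ.* (a ℤ.* k)) ℤ.* b ℤ.+ d ℤ.* e
    algebra = solve-∀

  -- For `r` representing x^P the tested list is x^P - 1.
  isPeriod : ℕ → List ℕ → Bool
  isPeriod d r = annihilates d 0 (r ⊕ (m ∷ []))

  isPeriod-sound : ∀ d {r P} → Power r P → T (isPeriod d r) → ∀ n → + d ℤ.* f (P + n) ≈ + d ℤ.* f n
  isPeriod-sound d {r} {P} hr t n = begin
    + d ℤ.* f (P + n)
      ≡⟨ cong (+ d ℤ.*_) (A-zero (P + n)) ⟨
    + d ℤ.* A (P + n) 0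
      -- The inserted term has the shape of `eval (m ∷ []) (A n)`, up to `m` for -1.
      ≡⟨ split (+ d) (A (P + n) 0) (A n 0) ⟩
    + d ℤ.* (A (P + n) 0 ℤ.+ (-1ℤ ℤ.* A n 0 ℤ.+ 0ℤ)) ℤ.+ + d ℤ.* A n 0
      ≈⟨ +-cong (*-congˡ (+ d) (+-cong (≈-sym (hr .shift n))
                                       (+-cong (*-congʳ (A n 0) (≈-sym m≈-1)) (≈-refl {0ℤ})))) ≈-refl ⟩
    + d ℤ.* (eval r (A n) ℤ.+ eval (m ∷ []) (A n)) ℤ.+ + d ℤ.* A n 0
      ≡⟨ cong (λ t → + d ℤ.* t ℤ.+ + d ℤ.* A n 0) (eval-⊕ r (m ∷ []) (A n)) ⟨
    + d ℤ.* eval (r ⊕ (m ∷ [])) (A n) ℤ.+ + d ℤ.* A n 0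
      ≈⟨ +-cong (annihilates-sound d 0 (r ⊕ (m ∷ [])) t n) ≈-refl ⟩
    0ℤ ℤ.+ + d ℤ.* A n 0
      ≡⟨ trans (ℤ.+-identityˡ _) (cong (+ d ℤ.*_) (A-zero n)) ⟩
    + d ℤ.* f n ∎
    where
    open ≈-Reasoning
    split : ∀ d a b → d ℤ.* a ≡ d ℤ.* (a ℤ.+ (-1ℤ ℤ.* b ℤ.+ 0ℤ)) ℤ.+ d ℤ.* b
    split = solve-∀

  iterate-period : ∀ d {P} → (∀ n → + d ℤ.* f (P + n) ≈ + d ℤ.* f n) →
                   ∀ a q → + d ℤ.* f (a + q * P) ≈ + d ℤ.* f a
  iterate-period d {P} h a zero    = ≡⇒≈ (cong (λ t → + d ℤ.* f t) (ℕ.+-identityʳ a))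
  iterate-period d {P} h a (suc q) = ≈-trans
    (≡⇒≈ (cong (λ t → + d ℤ.* f t) (swap a P (q * P))))
    (≈-trans (h (a + q * P)) (iterate-period d h a q))
    where
    swap : ∀ a b c → a + (b + c) ≡ b + (a + c)
    swap = ℕSolver.solve-∀

  -- Search through residue classes

  squarings : ℕ → List ℕ → List (List ℕ)
  squarings zero    r = []
  squarings (suc k) r = r ∷ squarings k (mul r r)

  module Search (period : ℕ) .{{_ : NonZero period}} (allowed : ℕ → Bool) where

    -- With p = x ^ a and r = x ^ P for the current r, a positive answer means that the zeros of f among
    -- the n ≡ a (mod P) have allowed residues. If d f is P-periodic modulo M, then a zero forces
    -- d f(a) ≡ 0; otherwise the class is split into the classes of a and P + a modulo 2P. Powers of
    -- two serve as d, halved with each doubling of P.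
    check : List (List ℕ) → ℕ → ℕ → List ℕ → Bool
    -- An exhausted depth counts as failure, so a positive answer covers every class.
    check []       P a p = false
    check (r ∷ rs) P a p =
      (not (isZero (d * constant p)) ∧ isPeriod d r)
      ∨ ((P % period ≡ᵇ 0) ∧ allowed (a % period))
      ∨ (check rs (P + P) a p ∧ check rs (P + P) (P + a) (mul r p))
      where
      d : ℕ
      d = 2 ^ length rs

    -- Induction on the number of squarings left, with one case per disjunct of `check`.
    check-sound : ∀ k r P a p → Power r P → Power p a → T (check (squarings k r) P a p) →
                  ∀ q → f (a + q * P) ≡ 0ℤ → T (allowed ((a + q * P) % period))
    check-sound (suc k) r P a p hr hp t q f≡0 =
      [ excluded ∘ Equivalence.to T-∧
      , [ permitted ∘ Equivalence.to T-∧ , halves ∘ Equivalence.to T-∧ ]′ ∘ Equivalence.to T-∨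
      ]′ (Equivalence.to T-∨ t)
      where
      Goal : Set
      Goal = T (allowed ((a + q * P) % period))

      rs : List (List ℕ)
      rs = squarings k (mul r r)

      d : ℕ
      d = 2 ^ length rs

      excluded : T (not (isZero (d * constant p))) × T (isPeriod d r) → Goal
      excluded (t₁ , t₂) = contradiction (≈0⇒isZero (d * constant p) zero-value) (T-not t₁)
        where
        T-not : ∀ {b} → T (not b) → T b → ⊥
        T-not {false} _ ()

        open ≈-Reasoning
        zero-value : + (d * constant p) ≈ 0ℤ
        zero-value = begin
          + (d * constant p)       ≡⟨ ℤ.pos-* d (constant p) ⟩
          + d ℤ.* + constant p     ≈⟨ *-congˡ (+ d) (constant-≈ hp) ⟩
          + d ℤ.* f a              ≈⟨ iterate-period d (isPeriod-sound d hr t₂) a q ⟨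
          + d ℤ.* f (a + q * P)    ≡⟨ cong (+ d ℤ.*_) f≡0 ⟩
          + d ℤ.* 0ℤ               ≡⟨ ℤ.*-zeroʳ (+ d) ⟩
          0ℤ                       ∎

      permitted : T (P % period ≡ᵇ 0) × T (allowed (a % period)) → Goal
      permitted (t₁ , t₂) with m%n≡0⇒n∣m P period (ℕ.≡ᵇ⇒≡ (P % period) 0 t₁)
      ... | divides c e = subst (T ∘ allowed) (sym residue) t₂
        where
        residue : (a + q * P) % period ≡ a % period
        residue = trans
          (cong (λ t → (a + t) % period) (trans (cong (q *_) e) (sym (ℕ.*-assoc q c period))))
          ([m+kn]%n≡m%n a (q * c) period)

      -- Even q puts a + qP into the class of a modulo 2P, odd q into that of P + a.
      halves : T (check rs (P + P) a p) × T (check rs (P + P) (P + a) (mul r p)) → Goal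
      halves (t₁ , t₂) with q divMod 2
      ... | result c zero e = subst (T ∘ allowed ∘ (_% period)) index
              (check-sound k (mul r r) (P + P) a p (mul-power hr hr) hp t₁ c (trans (cong f index) f≡0))
        where
        arith : ∀ a c P → a + c * (P + P) ≡ a + (0 + c * 2) * P
        arith = ℕSolver.solve-∀
        index : a + c * (P + P) ≡ a + q * P
        index = trans (arith a c P) (cong (λ t → a + t * P) (sym e))
      ... | result c (suc zero) e = subst (T ∘ allowed ∘ (_% period)) index
              (check-sound k (mul r r) (P + P) (P + a) (mul r p) (mul-power hr hr) (mul-power hr hp) t₂ c
                (trans (cong f index) f≡0))
        where
        arith : ∀ a c P → (P + a) + c * (P + P) ≡ a + (1 + c * 2) * P
        arith = ℕSolver.solve-∀
        index : (P + a) + c * (P + P) ≡ a + q * P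
        index = trans (arith a c P) (cong (λ t → a + t * P) (sym e))

    class-allowed : ∀ k {r P a p} → Power r P → Power p a → check (squarings k r) P a p ≡ true →
                    ∀ q {n} → n ≡ a + q * P → f n ≡ 0ℤ → T (allowed (n % period))
    class-allowed k hr hp e q refl = check-sound k _ _ _ _ hr hp (Equivalence.from T-≡ e) q

    zeros-allowed : ∀ k →
      check (squarings k x³) 3 0 (1 ∷ []) ≡ true →
      check (squarings k x³) 3 1 x ≡ true →
      check (squarings k x³) 3 2 x² ≡ true →
      ∀ n → f n ≡ 0ℤ → T (allowed (n % period))
    zeros-allowed k e₀ e₁ e₂ n with n divMod 3
    ... | result q zero             e = class-allowed k x³-power one-power e₀ q e
    ... | result q (suc zero)       e = class-allowed k x³-power x-power e₁ q e
    ... | result q (suc (suc zero)) e = class-allowed k x³-power x²-power e₂ q e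

-- The computation modulo 2^22

2^22∣24! : 4194304 ∣ 24 !
-- The exponent of 2 in 24! is 12 + 6 + 3 + 1 = 22; in 23! it is only 19.
2^22∣24! = m%n≡0⇒n∣m (24 !) 4194304 refl

exceptional : ℕ → Bool
exceptional r = (r ≡ᵇ 2) ∨ (r ≡ᵇ 2944838)

open Modular 4194303 24 2^22∣24!
open Search 3145728 exceptional

-- Proved by evaluation. The 23 levels are P = 3·2^j with d = 2^(22-j) for 0 ≤ j ≤ 22, so level j
-- tests f modulo 2^j; the allowed classes are accepted from j = 20 on, where 3145728 = 3·2^20
-- divides P.
check-0 : check (squarings 23 x³) 3 0 (1 ∷ []) ≡ true
check-0 = refl

check-1 : check (squarings 23 x³) 3 1 x ≡ true
check-1 = refl

check-2 : check (squarings 23 x³) 3 2 x² ≡ true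
check-2 = refl

zeros-exceptional : ∀ n → f n ≡ 0ℤ → T (exceptional (n % 3145728))
zeros-exceptional = zeros-allowed 23 check-0 check-1 check-2

theorem1p2 : (n : ℕ) → n % 3145728 ≢ 2 → n % 3145728 ≢ 2944838 → f n ≢ + 0
theorem1p2 n n≢2 n≢2944838 f≡0 =
  [ n≢2 ∘ ℕ.≡ᵇ⇒≡ (n % 3145728) 2 , n≢2944838 ∘ ℕ.≡ᵇ⇒≡ (n % 3145728) 2944838 ]′
    (Equivalence.to T-∨ (zeros-exceptional n f≡0))
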